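{- Let $P$ be a countable set of propositional symbols. There is no P-graph transformation $\dagger: \mathbb{G}(P)\times \mathcal{L}_0(P) \rightarrow \mathbb{G}(P)$ that induces Natural Revision. That is, there is no function $\dagger:\mathbb{G}(P)\times \mathcal{L}_0(P) \rightarrow \mathbb{G}(P)$ such that for all preference models $M$, all P-graphs $G\in\mathbb{G}(P)$ and all $\varphi\in\mathcal{L}_0(P)$, if $M$ is induced by $G$ then the natural revision $M_{\uparrow\varphi}$ is induced by $\dagger(G,\varphi)$.
   Context: $\mathcal{L}_0(P)$ is the set of classical propositional formulas over $P$. P-graph: a pair $G=\langle\Phi,\prec\rangle$ with $\Phi\subseteq\mathcal{L}_0(P)$ and $\prec$ a strict partial order on $\Phi$. $\mathbb{G}(P)$ is the set of all P-graphs over $P$. A P-graph transformation is any function $\dagger:\mathbb{G}(P)\times\mathcal{L}_0(P)\to\mathbb{G}(P)$. Given a non-empty set $W$ of worlds and a valuation $v:P\to 2^W$, $w\vDash\varphi$ denotes classical satisfaction of $\varphi$ at $w$ (with $w\vDash p$ iff $w\in v(p)$), and $\llbracket\varphi\rrbracket=\{w\in W: w\vDash\varphi\}$. The relation $\leq_G$ on $W$ is: $w\leq_G w'$ iff for every $\varphi\in\Phi$, either ($w'\vDash\varphi$ implies $w\vDash\varphi$), or there is $\psi\in\Phi$ with $\psi\prec\varphi$, $w\vDash\psi$ and $w'\not\vDash\psi$. Preference model: $M=\langle W,\leq,v\rangle$ with $W$ a non-empty set, $v:P\to 2^W$, and $\leq$ a reflexive transitive relation on $W$ whose strict part $<$ ($w<w'$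 iff $w\leq w'$ and not $w'\leq w$) is well-founded. For $X\subseteq W$, $\mathit{Min}_\leq X=\{w\in X:\text{ there is no } w'\in X \text{ with } w'<w\}$. $M$ is induced by a P-graph $G$ iff $\leq\;=\;\leq_G$ (computed with $W$ and $v$). Natural revision of $M=\langle W,\leq,v\rangle$ by $\varphi\in\mathcal{L}_0(P)$: the preference model $M_{\uparrow\varphi}=\langle W,\leq_{\uparrow\varphi},v\rangle$, where $w\leq_{\uparrow\varphi}w'$ iff $w\in\mathit{Min}_\leq\llbracket\varphi\rrbracket$, or ($w\leq w'$ and $w,w'\notin\mathit{Min}_\leq\llbracket\varphi\rrbracket$).
   Formalization: The set P of propositional symbols is additionally required to contain at least two distinct symbols, since for an empty or one-element P a P-graph transformation inducing Natural Revision does exist (for empty P, the identity on graphs). -}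

module Defs where

open import Level using (0ℓ) renaming (suc to lsuc)
open import Data.Bool using (Bool; true; false; T; not; _∧_; _∨_)
open import Data.Product using (_×_; _,_; ∃)
open import Data.Sum using (_⊎_; inj₁; inj₂)
open import Function.Bundles using (_⇔_)
open import Induction.WellFounded using (WellFounded; Acc; acc)
open import Relation.Binary using (Rel; IsStrictPartialOrder; IsPreorder)
open import Relation.Binary.PropositionalEquality using (_≡_; refl; isEquivalence)
open import Relation.Nullary using (¬_; yes; no; contradiction)
open import Relation.Unary using (Pred; _∈_; _∉_; Decidable)

infix  8 ¬′_
infixr 7 _∧′_
infixr 6 _∨′_
infixr 5 _⇒′_

data Formula (P : Set) : Set where
  var            : P → Formula P
  ⊤′ ⊥′          : Formula P
  ¬′_            : Formula P → Formula P
  _∧′_ _∨′_ _⇒′_ : Formula P → Formula P → Formula P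

-- An element of P → 2^W.  Valuations take values in Bool, not in Set, so that
-- satisfaction obeys classical logic.
Valuation : Set → Set → Set
Valuation P W = P → W → Bool

eval : {P W : Set} → Valuation P W → W → Formula P → Bool
eval v w (var p)  = v p w
eval v w ⊤′       = true
eval v w ⊥′       = false
eval v w (¬′ φ)   = not (eval v w φ)
eval v w (φ ∧′ ψ) = eval v w φ ∧ eval v w ψ
eval v w (φ ∨′ ψ) = eval v w φ ∨ eval v w ψ
eval v w (φ ⇒′ ψ) = not (eval v w φ) ∨ eval v w ψ

Sat : {P W : Set} → Valuation P W → W → Formula P → Set
Sat v w φ = T (eval v w φ)

⟦_⟧ : {P W : Set} → Formula P → Valuation P W → Pred W 0ℓ
⟦ φ ⟧ v w = Sat v w φ

-- A relation on the subset Φ is encoded as a relation on all formulas that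
-- only relates members of Φ.
record PGraph (P : Set) : Set (lsuc 0ℓ) where
  field
    Φ                    : Pred (Formula P) 0ℓ
    _≺_                  : Rel (Formula P) 0ℓ
    ≺-on-Φ               : ∀ {φ ψ} → φ ≺ ψ → φ ∈ Φ × ψ ∈ Φ
    isStrictPartialOrder : IsStrictPartialOrder _≡_ _≺_

PGraphTransformation : Set → Set (lsuc 0ℓ)
PGraphTransformation P = PGraph P → Formula P → PGraph P

graphOrder : {P W : Set} → PGraph P → Valuation P W → Rel W 0ℓ
graphOrder G v w w′ = ∀ φ → φ ∈ Φ →
    (Sat v w′ φ → Sat v w φ)
  ⊎ (∃ λ ψ → ψ ∈ Φ × ψ ≺ φ × Sat v w ψ × ¬ Sat v w′ ψ)
  where open PGraph G

Strict : {W : Set} → Rel W 0ℓ → Rel W 0ℓ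
Strict _≤_ w w′ = w ≤ w′ × ¬ (w′ ≤ w)

Min : {W : Set} → Rel W 0ℓ → Pred W 0ℓ → Pred W 0ℓ
Min _≤_ X w = w ∈ X × ¬ (∃ λ w′ → w′ ∈ X × Strict _≤_ w′ w)

-- A triple ⟨W, ≤, v⟩ with W non-empty; the conditions on ≤ are kept apart in
-- IsPreferenceModel.
record Model (P : Set) : Set (lsuc 0ℓ) where
  field
    W     : Set
    point : W
    _≤_   : Rel W 0ℓ
    v     : Valuation P W

record IsPreferenceModel {P : Set} (M : Model P) : Set where
  open Model M
  field
    isPreorder    : IsPreorder _≡_ _≤_
    <-wellFounded : WellFounded (Strict _≤_)

InducedBy : {P : Set} → Model P → PGraph P → Set
InducedBy M G = ∀ w w′ → w ≤ w′ ⇔ graphOrder G v w w′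
  where open Model M

minWorlds : {P : Set} (M : Model P) → Formula P → Pred (Model.W M) 0ℓ
minWorlds M φ = Min _≤_ (⟦ φ ⟧ v)
  where open Model M

naturalRevision : {P : Set} → Model P → Formula P → Model P
naturalRevision M φ = record
  { W     = W
  ; point = point
  ; _≤_   = λ w w′ → w ∈ minWorlds M φ
                   ⊎ (w ≤ w′ × w ∉ minWorlds M φ × w′ ∉ minWorlds M φ)
  ; v     = v
  }
  where open Model M

InducesNaturalRevision : {P : Set} → PGraphTransformation P → Set (lsuc 0ℓ)
InducesNaturalRevision {P} † =
  ∀ (M : Model P) → IsPreferenceModel M → ∀ (G : PGraph P) (φ : Formula P) →
  InducedBy M G → InducedBy (naturalRevision M φ) († G φ)

-- Natural revision yields a preference model.  Decidability of minimality is
-- automatic classically; constructively it is what reflexivity requires.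
naturalRevision-isPreferenceModel :
  {P : Set} (M : Model P) (φ : Formula P) → IsPreferenceModel M →
  Decidable (minWorlds M φ) → IsPreferenceModel (naturalRevision M φ)
naturalRevision-isPreferenceModel M φ isPM min? = record
  { isPreorder = record
    { isEquivalence = isEquivalence
    ; reflexive     = λ { refl → ≤′-refl _ }
    ; trans         = ≤′-trans
    }
  ; <-wellFounded = λ w → wf (<-wellFounded w)
  }
  where
  open Model M
  open IsPreferenceModel isPM
  open IsPreorder isPreorder using () renaming (refl to ≤-refl; trans to ≤-trans)
  open Model (naturalRevision M φ) using () renaming (_≤_ to _≤′_)

  ≤′-refl : ∀ w → w ≤′ w
  ≤′-refl w with min? w
  ... | yes m = inj₁ m
  ... | no ¬m = inj₂ (≤-refl , ¬m , ¬m)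

  ≤′-trans : ∀ {x y z} → x ≤′ y → y ≤′ z → x ≤′ z
  ≤′-trans (inj₁ m) _ = inj₁ m
  ≤′-trans (inj₂ (_ , _ , ¬m)) (inj₁ m) = contradiction m ¬m
  ≤′-trans (inj₂ (x≤y , ¬x , _)) (inj₂ (y≤z , _ , ¬z)) = inj₂ (≤-trans x≤y y≤z , ¬x , ¬z)

  min-acc : ∀ {w} → w ∈ minWorlds M φ → Acc (Strict _≤′_) w
  min-acc m = acc λ { (_ , w≰′x) → contradiction (inj₁ m) w≰′x }

  wf : ∀ {w} → Acc (Strict _≤_) w → Acc (Strict _≤′_) w
  wf (acc rs) = acc λ
    { (inj₁ m , _)                  → min-acc m
    ; (inj₂ (x≤w , ¬x , ¬w) , w≰′x) →
        wf (rs (x≤w , λ w≤x → w≰′x (inj₂ (w≤x , ¬w , ¬x))))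
    }

{-# OPTIONS --safe #-}
-- The order induced by a P-graph is local: whether w ≤ w′ depends only on the
-- valuations at w and w′.  Natural revision is not local.  Take a chain
-- 0 < 1 < 2 and a formula φ false exactly at 0.  Revising the whole chain by φ
-- promotes world 1, so 0 stays strictly below 2; revising the submodel {0, 2}
-- promotes world 2, putting it below 0.  Both models are induced by the same
-- P-graph, so the revised graph would have to order 0 and 2 in both ways.
module Submission where

open import Defs
open import Data.Bool using (T; not; _∧_; _∨_; if_then_else_)
open import Data.Empty using (⊥)
open import Data.Fin using (Fin; _≤_; punchIn; toℕ)
open import Data.Fin.Induction using (<-wellFounded)
open import Data.Fin.Patterns using (0F; 1F; 2F)
open import Data.Fin.Properties using (≤-isPreorder)
open import Data.Nat using (ℕ; _≤ᵇ_; z≤n; s≤s)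
open import Data.Nat.Properties
  using (≰⇒>; ≤ᵇ⇒≤; ≤⇒≤ᵇ) renaming (_≟_ to _≟ℕ_)
open import Data.Product using (∃; ∃₂; _,_; proj₁)
open import Data.Sum using (inj₁; inj₂; [_,_]; map)
open import Function using (_∘_; _on_)
open import Function.Bundles using (_⇔_; _↣_; mk⇔; Equivalence)
open import Induction.WellFounded using (module Subrelation)
open import Relation.Binary using (IsPreorder; DecidableEquality)
import Relation.Binary.Construct.On as On
open import Relation.Binary.PropositionalEquality
  using (_≡_; _≢_; refl; sym; cong; cong₂; subst; isEquivalence; resp₂)
open import Relation.Nullary using (¬_; does)
open import Relation.Nullary.Decidable
  using (dec-true; dec-false; via-injection)

open Equivalence using (to; from)

module _ {P W X : Set} (v : Valuation P W) (e : X → W) where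

  restrictValuation : Valuation P X
  restrictValuation r x = v r (e x)

  eval-restrict : ∀ x φ → eval restrictValuation x φ ≡ eval v (e x) φ
  eval-restrict x (var r)  = refl
  eval-restrict x ⊤′       = refl
  eval-restrict x ⊥′       = refl
  eval-restrict x (¬′ φ)   = cong not (eval-restrict x φ)
  eval-restrict x (φ ∧′ ψ) = cong₂ _∧_ (eval-restrict x φ) (eval-restrict x ψ)
  eval-restrict x (φ ∨′ ψ) = cong₂ _∨_ (eval-restrict x φ) (eval-restrict x ψ)
  eval-restrict x (φ ⇒′ ψ) =
    cong₂ (λ a b → not a ∨ b) (eval-restrict x φ) (eval-restrict x ψ)

  Sat-restrict : ∀ x φ → Sat restrictValuation x φ ⇔ Sat v (e x) φ
  Sat-restrict x φ =
    mk⇔ (subst T (eval-restrict x φ)) (subst T (sym (eval-restrict x φ)))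

  -- This is the locality of the order: its definition inspects satisfaction at the two compared
  -- worlds only and quantifies over formulas, never over further worlds. The map `e` may be
  -- arbitrary.
  graphOrder-restrict : ∀ G x y →
    graphOrder G restrictValuation x y ⇔ graphOrder G v (e x) (e y)
  graphOrder-restrict G x y = mk⇔
    (λ x≤y φ φ∈Φ → map
      (λ y⇒x → to (Sat-restrict x φ) ∘ y⇒x ∘ from (Sat-restrict y φ))
      (λ (ψ , ψ∈Φ , ψ≺φ , xψ , ¬yψ) →
        ψ , ψ∈Φ , ψ≺φ , to (Sat-restrict x ψ) xψ , ¬yψ ∘ from (Sat-restrict y ψ))
      (x≤y φ φ∈Φ))
    (λ x≤y φ φ∈Φ → map
      (λ y⇒x → from (Sat-restrict x φ) ∘ y⇒x ∘ to (Sat-restrict y φ))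
      (λ (ψ , ψ∈Φ , ψ≺φ , xψ , ¬yψ) →
        ψ , ψ∈Φ , ψ≺φ , from (Sat-restrict x ψ) xψ , ¬yψ ∘ to (Sat-restrict y ψ))
      (x≤y φ φ∈Φ))

submodel : ∀ {P X} (M : Model P) → (X → Model.W M) → X → Model P
submodel {X = X} M e x = record
  { W     = X
  ; point = x
  ; _≤_   = _≤ᴹ_ on e
  ; v     = restrictValuation v e
  }
  where open Model M renaming (_≤_ to _≤ᴹ_)

module _ {P X : Set} (M : Model P) (e : X → Model.W M) (x : X) where

  submodel-isPreferenceModel :
    IsPreferenceModel M → IsPreferenceModel (submodel M e x)
  submodel-isPreferenceModel isPM = record
    { isPreorder    = record
      { isEquivalence = isEquivalence
      ; reflexive     = λ { refl → IsPreorder.refl isPreorder }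
      ; trans         = IsPreorder.trans isPreorder
      }
    ; <-wellFounded = On.wellFounded e <ᴹ-wellFounded
    }
    where
    open IsPreferenceModel isPM renaming (<-wellFounded to <ᴹ-wellFounded)

  submodel-inducedBy : ∀ G → InducedBy M G → InducedBy (submodel M e x) G
  submodel-inducedBy G ind y z = mk⇔
    (from local ∘ to (ind (e y) (e z)))
    (from (ind (e y) (e z)) ∘ to local)
    where local = graphOrder-restrict (Model.v M) e G y z

-- With no priorities, the induced order is the specialization preorder of the family: `w` lies
-- below `u` when it satisfies every `θ i` that `u` does.
flatGraph : ∀ {P I : Set} → (I → Formula P) → PGraph P
flatGraph θ = record
  { Φ                    = λ φ → ∃ λ i → φ ≡ θ i
  ; _≺_                  = λ _ _ → ⊥
  ; ≺-on-Φ               = λ ()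
  ; isStrictPartialOrder = record
    { isEquivalence = isEquivalence
    ; irrefl        = λ _ ()
    ; trans         = λ ()
    ; <-resp-≈      = resp₂ _
    }
  }

-- A preorder is recovered from its principal down-sets: transitivity makes them downward closed,
-- and by reflexivity `u` lies in its own, so testing `θ u` suffices for the converse.
flatGraph-induces : ∀ {P} (M : Model P) → IsPreferenceModel M →
  let open Model M renaming (_≤_ to _≤ᴹ_) in
  (θ : W → Formula P) → (∀ w u → Sat v w (θ u) ⇔ w ≤ᴹ u) →
  InducedBy M (flatGraph θ)
flatGraph-induces M isPM θ θ-down w u = mk⇔
  (λ { w≤u _ (i , refl) →
       inj₁ (λ uθ → from (θ-down w i) (M.trans w≤u (to (θ-down u i) uθ))) })
  (λ w≤u → [ (λ u⇒w → to (θ-down w u) (u⇒w (from (θ-down u u) M.refl)))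
           , (λ ()) ] (w≤u (θ u) (u , refl)))
  where module M = IsPreorder (IsPreferenceModel.isPreorder isPM)

module Counterexample {P : Set} (_≟_ : DecidableEquality P)
                      {p q : P} (p≢q : p ≢ q) where

  -- The top of the initial segment of the chain on which a symbol holds: `p` holds at 0 alone, `q`
  -- at 0 and 1. Symbols other than `p` and `q` share the level of `q` as a default.
  level : P → Fin 3
  level r = if does (r ≟ p) then 0F else 1F

  level-p : level p ≡ 0F
  level-p = cong (if_then 0F else 1F) (dec-true (p ≟ p) refl)

  level-q : level q ≡ 1F
  level-q = cong (if_then 0F else 1F) (dec-false (q ≟ p) (p≢q ∘ sym))

  chain : Model P
  chain = record
    { W     = Fin 3
    ; point = 0F
    ; _≤_   = _≤_
    ; v     = λ r w → toℕ w ≤ᵇ toℕ (level r)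
    }

  open Model chain using (v)

  chain-isPreferenceModel : IsPreferenceModel chain
  chain-isPreferenceModel = record
    { isPreorder    = ≤-isPreorder
    ; <-wellFounded =
        Subrelation.wellFounded (λ (_ , y≰x) → ≰⇒> y≰x) <-wellFounded
    }

  atMost : Fin 3 → Formula P
  atMost 0F = var p
  atMost 1F = var q
  atMost 2F = ⊤′

  eval-atMost : ∀ w k → eval v w (atMost k) ≡ (toℕ w ≤ᵇ toℕ k)
  eval-atMost w  0F = cong (λ k → toℕ w ≤ᵇ toℕ k) level-p
  eval-atMost w  1F = cong (λ k → toℕ w ≤ᵇ toℕ k) level-q
  eval-atMost 0F 2F = refl
  eval-atMost 1F 2F = refl
  eval-atMost 2F 2F = refl

  Sat-atMost : ∀ w k → Sat v w (atMost k) ⇔ w ≤ k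
  Sat-atMost w k = mk⇔
    (≤ᵇ⇒≤ (toℕ w) (toℕ k) ∘ subst T (eval-atMost w k))
    (subst T (sym (eval-atMost w k)) ∘ ≤⇒≤ᵇ)

  G : PGraph P
  G = flatGraph atMost

  chain-inducedBy : InducedBy chain G
  chain-inducedBy =
    flatGraph-induces chain chain-isPreferenceModel atMost Sat-atMost

  -- World 1F of endsModel is world 2F of the chain.
  ends : Fin 2 → Fin 3
  ends = punchIn 1F

  endsModel : Model P
  endsModel = submodel chain ends 0F

  φ : Formula P
  φ = ¬′ atMost 0F

  eval-φ : ∀ w → eval v w φ ≡ not (toℕ w ≤ᵇ 0)
  eval-φ w = cong not (eval-atMost w 0F)

  1-sat : Sat v 1F φ
  1-sat = subst T (sym (eval-φ 1F)) _

  2-sat : Sat v 2F φ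
  2-sat = subst T (sym (eval-φ 2F)) _

  2-minimal-in-ends : minWorlds endsModel φ 1F
  2-minimal-in-ends = 2-sat , λ
    -- The concrete `φ` unfolds under restriction, so satisfaction here is already satisfaction at
    -- the image world in the chain.
    { (0F , 0-sat , _)   → subst T (eval-φ 0F) 0-sat
    ; (1F , _ , _ , 2≰2) → 2≰2 (s≤s (s≤s z≤n))
    }

  2-not-minimal : ¬ minWorlds chain φ 2F
  2-not-minimal (_ , none-below) =
    none-below (1F , 1-sat , s≤s z≤n , λ { (s≤s ()) })

  not-induced : ∀ G′ → InducedBy (naturalRevision endsModel φ) G′ →
    ¬ InducedBy (naturalRevision chain φ) G′
  not-induced G′ ends-ind chain-ind =
    -- Revision can place 2 below 0 only by promoting 2 or by keeping a comparison from the chain,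
    -- where 2 is not below 0.
    [ 2-not-minimal , (λ ()) ∘ proj₁ ] (from (chain-ind 2F 0F) 2≤0)
    where
    2≤0 : graphOrder G′ v 2F 0F
    2≤0 = to (graphOrder-restrict v ends G′ 1F 0F)
             (to (ends-ind 1F 0F) (inj₁ 2-minimal-in-ends))

corollary23 : (P : Set) → P ↣ ℕ → (∃₂ λ (p q : P) → p ≢ q) →
    ¬ (∃ λ († : PGraphTransformation P) → InducesNaturalRevision †)
corollary23 P P↣ℕ (p , q , p≢q) († , induces) =
  -- `†` sees only the pair `G`, `φ`, so a single graph has to induce both revisions.
  not-induced († G φ)
    (induces endsModel
      (submodel-isPreferenceModel chain ends 0F chain-isPreferenceModel)
      G φ (submodel-inducedBy chain ends 0F G chain-inducedBy))
    (induces chain chain-isPreferenceModel G φ chain-inducedBy)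
  -- Countability enters here: the injection into the naturals yields the decidable equality that
  -- `level` tests.
  where open Counterexample (via-injection P↣ℕ _≟ℕ_) p≢q
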